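{- Let $1\le\alpha<2$ be a constant. Then there is a constant $C_\alpha$ such that every simple graph $G$ on $n$ vertices satisfies $\mathrm{cdim}_\alpha(G)\le C_\alpha n$, i.e. $\mathrm{cdim}_\alpha(G)=O(n)$.
   Context: A simple graph is an unweighted graph $G=(V,E)$ (all edges weight 1). For $\emptyset\ne X\subsetneq V$, the cut $\Delta(X)$ is the set of edges with exactly one endpoint in $X$, with weight $|\Delta(X)|$. Let $\lambda$ be the minimum cut weight. An $\alpha$-near-mincut is a cut of weight at most $\alpha\lambda$; $\mathcal{M}_\alpha(G)$ is the set of $\alpha$-near-mincuts. For $S\subseteq E$, $\chi(S)\in\{0,1\}^{|E|}$ is its characteristic vector; $\mathrm{cdim}_\alpha(G)=\dim\mathrm{span}\{\chi(S):S\in\mathcal{M}_\alpha(G)\}$. -}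

module Defs where

open import Data.Nat as ℕ using (ℕ; zero; suc)
open import Data.Fin using (Fin; zero; suc; _<_)
open import Data.Fin.Properties using (_<?_)
open import Data.Bool using (Bool; true; false; _∧_; _xor_; if_then_else_)
open import Data.Product using (Σ; ∃; _×_; _,_; proj₁; proj₂)
open import Data.List using (List; allFin; map)
open import Data.Nat.ListAction using (sum)
open import Data.Integer using (+_)
open import Data.Rational as ℚ using (ℚ; 0ℚ; 1ℚ)
open import Relation.Binary.PropositionalEquality using (_≡_)
open import Relation.Nullary using (⌊_⌋)

record SimpleGraph (n : ℕ) : Set where
  field
    adj    : Fin n → Fin n → Bool
    sym    : ∀ i j → adj i j ≡ adj j i
    irrefl : ∀ i → adj i i ≡ false
open SimpleGraph public

Edge : ∀ {n} → SimpleGraph n → Set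
Edge {n} G = Σ (Fin n × Fin n) λ p → (proj₁ p < proj₂ p) × (adj G (proj₁ p) (proj₂ p) ≡ true)

VertexSet : ℕ → Set
VertexSet n = Fin n → Bool

IsCut : ∀ {n} → VertexSet n → Set
IsCut X = (∃ λ v → X v ≡ true) × (∃ λ v → X v ≡ false)

crosses : ∀ {n} → VertexSet n → Fin n → Fin n → Bool
crosses X i j = X i xor X j

cutWeight : ∀ {n} → SimpleGraph n → VertexSet n → ℕ
cutWeight {n} G X =
  sum (map (λ i → sum (map (λ j →
    if ⌊ i <? j ⌋ ∧ adj G i j ∧ crosses X i j then 1 else 0)
    (allFin n))) (allFin n))

ℕ→ℚ : ℕ → ℚ
ℕ→ℚ m = (+ m) ℚ./ 1

-- X is an α-near-mincut: Δ(X) is a cut with |Δ(X)| ≤ α λ, where λ is the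
-- minimum cut weight (written out: |Δ(X)| ≤ α |Δ(Y)| for every cut Y).
NearMincut : ∀ {n} → ℚ → SimpleGraph n → VertexSet n → Set
NearMincut {n} α G X =
  IsCut X × (∀ (Y : VertexSet n) → IsCut Y →
               ℕ→ℚ (cutWeight G X) ℚ.≤ α ℚ.* ℕ→ℚ (cutWeight G Y))

χΔ : ∀ {n} (G : SimpleGraph n) → VertexSet n → Edge G → ℚ
χΔ G X ((i , j) , _) = if crosses X i j then 1ℚ else 0ℚ

Σℚ : ∀ {k} → (Fin k → ℚ) → ℚ
Σℚ {zero}  f = 0ℚ
Σℚ {suc k} f = f zero ℚ.+ Σℚ (λ t → f (suc t))

LinearlyIndependent : ∀ {k} {I : Set} → (Fin k → I → ℚ) → Set
LinearlyIndependent {k} {I} v =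
  ∀ (c : Fin k → ℚ) → (∀ (e : I) → Σℚ (λ t → c t ℚ.* v t e) ≡ 0ℚ) → ∀ t → c t ≡ 0ℚ

-- cdim_α(G) ≤ d : dim span {χ(S) : S ∈ M_α(G)} ≤ d, i.e. every linearly
-- independent family of characteristic vectors of α-near-mincuts has size ≤ d.
CdimAtMost : ∀ {n} → ℚ → SimpleGraph n → ℕ → Set
CdimAtMost {n} α G d =
  ∀ (k : ℕ) (X : Fin k → VertexSet n) →
    (∀ t → NearMincut α G (X t)) →
    LinearlyIndependent (λ t → χΔ G (X t)) →
    k ℕ.≤ d

{-# OPTIONS --safe #-}

-- A cut Δ(X) with both sides of size at least 2 is called non-trivial; the other cuts are
-- vertex stars and span a space of dimension at most n. So it is enough that only O(n) edges
-- lie in some non-trivial near-mincut. Let d be the minimum degree. Moving one vertex v across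
-- a non-trivial near-mincut Δ(Z) yields a cut, whence v has Ω(d) neighbours on its own side of Z.
--
-- Cut V recursively: as long as a non-trivial near-mincut Z separates two vertices of a part K,
-- replace K by K ∩ Z and K ∖ Z, at the cost of |Δ(Z)| ≤ 2d newly cut edges. There are O(n/d)
-- parts of size Ω(d), and the splittings that cut off a small part are paid for by the potential
--     Ψ(K) = Σ_{u ∉ K} min(d, M e(u, K)),
-- which depends on K alone, not on how it arose. Splitting K in any way increases the total
-- potential by at most 2 M |Δ(Z)| = O(d), since each u has the edges to one of the two new parts
-- in Δ(Z). If S = K ∩ Z is small, each v ∈ S has Ω(d) neighbours in Z ∖ K, most of which have
-- few edges to K ∖ Z because these lie in Δ(Z); so Ψ(K ∖ Z) is smaller than Ψ(K) by Ω(d |S|).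
module Submission where

open import Defs
open import Algebra.Bundles using (CommutativeRing)
import Algebra.Properties.Semiring.Sum
open import Data.Bool using (Bool; true; false; _∧_; _xor_; not; if_then_else_)
import Data.Bool as 𝔹
open import Data.Bool.Properties using (not-involutive; ∧-comm; ¬-not)
open import Data.Empty using (⊥-elim)
open import Data.Fin as Fin using (Fin; zero; suc; punchIn)
open import Data.Fin.Properties using (_≟_; _<?_; <-cmp; <⇒≢; any?; all?; ¬∀⟶∃¬)
open import Data.Integer using (+_)
import Data.Integer as ℤ
import Data.Integer.Properties as ℤₚ
open import Data.List using (List; []; _∷_; _++_; map; concatMap; allFin; tabulate; length)
open import Data.List.Membership.Propositional using (_∈_; lose)
open import Data.List.Membership.Propositional.Properties
  using (∈-++⁺ˡ; ∈-++⁺ʳ; ∈-concatMap⁺; ∈-allFin; ∈-map⁺)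
open import Data.List.Properties
  using (map-tabulate; map-cong; length-++; length-map; length-tabulate)
open import Data.List.Relation.Unary.All using (All)
import Data.List.Relation.Unary.All as All
import Data.List.Relation.Unary.All.Properties as All
open import Data.List.Relation.Unary.Any using (here)
open import Data.Nat using (ℕ; zero; suc; _+_; _*_; _⊓_; _≤?_; z≤n; s≤s)
import Data.Nat as ℕ
import Data.Nat.ListAction as ListAction
open import Data.Nat.Properties
  using ( ≤-refl; ≤-reflexive; ≤-trans; ≤-total; <⇒≤; ≰⇒>; ≮⇒≥; m≤n⇒m≤1+n; suc-injective
        ; +-mono-≤; +-cancelʳ-≤; *-monoʳ-≤; *-cancelˡ-≤; m≤m+n; m≤n+m
        ; +-comm; +-identityʳ; *-comm; *-zeroʳ; *-identityʳ; +-*-semiring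
        ; m⊓n≤m; m⊓n≤n; ⊓-mono-≤; m≥n⇒m⊓n≡n)
  renaming (module ≤-Reasoning to ≤-R)
open import Data.Nat.Tactic.RingSolver using (solve)
open import Data.Product using (∃; ∃₂; _×_; _,_; proj₁; proj₂)
open import Data.Rational using (ℚ; 0ℚ; 1ℚ; mkℚ; _≤_; _<_; _/_)
import Data.Rational as ℚ
import Data.Rational.Properties as ℚₚ
import Data.Rational.Solver as ℚSolver
open import Data.Rational.Unnormalised using (mkℚᵘ)
import Data.Rational.Unnormalised as ℚᵘ
import Data.Rational.Unnormalised.Properties as ℚᵘₚ
open import Data.Sum using (_⊎_; inj₁; inj₂)
open import Data.Vec.Functional using (insertAt)
open import Data.Vec.Functional.Properties using (insertAt-lookup; insertAt-punchIn)
open import Function using (_∘_; case_of_)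
open import Relation.Binary using (tri<; tri≈; tri>)
open import Relation.Binary.PropositionalEquality renaming (sym to ≡-sym)
open import Relation.Nullary using (Dec; ⌊_⌋; yes; no; does; ¬_)
open import Relation.Nullary.Decidable
  using (dec-true; dec-false; _×-dec_; _→-dec_; ¬?; decidable-stable)
open Algebra.Properties.Semiring.Sum +-*-semiring
  using (sum; sum-cong-≗; sum-replicate-zero; ∑-distrib-+; ∑-comm; *-distribˡ-sum; *-distribʳ-sum)

-- Inequalities between natural numbers for the recursion.

-- A hypothesis a ≤ b, usually a combination of inequalities, entails L ≤ R
-- as soon as L + b + z ≡ R + a, which is left to the ring solver.
≤-by : ∀ {a b L R} z → a ℕ.≤ b → L + b + z ≡ R + a → L ℕ.≤ R
≤-by {a} {b} {L} {R} z a≤b eq = +-cancelʳ-≤ a L R (begin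
  L + a      ≤⟨ +-mono-≤ (≤-refl {L}) a≤b ⟩
  L + b      ≤⟨ m≤m+n (L + b) z ⟩
  L + b + z  ≡⟨ eq ⟩
  R + a      ∎)
  where open ≤-R

infixr 2 _+≤_
infixr 3 _*≤_

_+≤_ : ∀ {a b c d} → a ℕ.≤ b → c ℕ.≤ d → a + c ℕ.≤ b + d
_+≤_ = +-mono-≤

_*≤_ : ∀ {a b} c → a ℕ.≤ b → c * a ℕ.≤ c * b
c *≤ h = *-monoʳ-≤ c h

-- Here `x` and `y` are the cut weights before and after moving a vertex with `i` neighbours on its
-- own side and `o` across. Since y ≤ x + 2i - d, the two ratio bounds combine to (1 + p)(d - 2i) ≤
-- p d.
flip-bound : ∀ p d x y i o →
  (1 + p) * x ℕ.≤ (1 + 2 * p) * d → (1 + p) * x ℕ.≤ (1 + 2 * p) * y →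
  y + o ℕ.≤ x + i → d ℕ.≤ i + o → d ℕ.≤ 2 * (1 + p) * i
flip-bound p d x y i o hd hy hf hdeg = *-cancelˡ-≤ (1 + 2 * p)
  (≤-by 0 ((1 + p) *≤ hy +≤ p *≤ hd +≤ (1 + p) * (1 + 2 * p) *≤ hf +≤ (1 + p) * (1 + 2 * p) *≤ hdeg)
    (solve (p ∷ d ∷ x ∷ y ∷ i ∷ o ∷ [])))

-- The gain in the truncated count when a further edges are added to r, linearised so that it
-- can be summed: if r is already large, the last term outweighs the loss by truncation.
peel-term : ∀ d M s a r → 2 * M * s ℕ.≤ d → a ℕ.≤ s →
  d * (d ⊓ (M * r)) + M * d * a ℕ.≤ d * (d ⊓ (M * (a + r))) + 2 * M * (M * s) * r
peel-term d M s a r hs ha with ≤-total (2 * M * r) d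
... | inj₁ hr = begin
  d * (d ⊓ (M * r)) + M * d * a                 ≤⟨ d *≤ m⊓n≤n d (M * r) +≤ ≤-refl ⟩
  d * (M * r) + M * d * a                       ≡⟨ solve (d ∷ M ∷ a ∷ r ∷ []) ⟩
  d * (M * (a + r))                             ≡⟨ cong (d *_) (m≥n⇒m⊓n≡n fits) ⟨
  d * (d ⊓ (M * (a + r)))                       ≤⟨ m≤m+n _ _ ⟩
  d * (d ⊓ (M * (a + r))) + 2 * M * (M * s) * r ∎
  where
  open ≤-R
  fits : M * (a + r) ℕ.≤ d
  fits = *-cancelˡ-≤ 2 (≤-by 0 (hs +≤ hr +≤ 2 * M *≤ ha) (solve (d ∷ M ∷ s ∷ a ∷ r ∷ [])))
... | inj₂ hr =
  d *≤ ⊓-mono-≤ (≤-refl {d}) (M *≤ m≤n+m r a) +≤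
  ≤-by 0 (M * s *≤ hr +≤ M * d *≤ ha) (solve (d ∷ M ∷ s ∷ a ∷ r ∷ []))

-- After division by `d`, the gain M T is at least 4 s d - s d / 2, because M = 4 Q and 2 M s ≤ d.
-- The losses are at most s d from the last term and, by 8 M² ≤ d, at most s d / 2 from the term in
-- `W`.
peel-arith : ∀ d Q M s T W Ψ Ψ′ → .{{ℕ.NonZero d}} → M ≡ 4 * Q →
  d * Ψ′ + M * d * T ℕ.≤ d * Ψ + 2 * M * (M * s) * W + d * d * s →
  W ℕ.≤ 2 * d → s * d ℕ.≤ Q * T + Q * (s * s) → 2 * M * s ℕ.≤ d →
  8 * M * M ℕ.≤ d → Ψ′ + 2 * (s * d) ℕ.≤ Ψ
peel-arith d Q _ s T W Ψ Ψ′ refl h1 hW hT hs hd = *-cancelˡ-≤ d (*-cancelˡ-≤ 2 (≤-by 0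
  (2 *≤ h1 +≤ 64 * Q * Q * s *≤ hW +≤ s * d *≤ hd +≤ 8 * d *≤ hT +≤ d * s *≤ hs)
  (solve (d ∷ Q ∷ s ∷ T ∷ W ∷ Ψ ∷ Ψ′ ∷ []))))

-- The bound for a part with more than d / 2M vertices; ℓ is the number of edges cut inside it.
-- The slack 2 d (1 + 4 M) on the left pays for splitting it into two such parts.
Bounded : (d M k Ψ ℓ : ℕ) → Set
Bounded d M k Ψ ℓ = ℓ + 2 * (d * (1 + 4 * M)) ℕ.≤ 2 * (2 * M * (1 + 4 * M) * k + Ψ)

-- The invariant is ℓ ≤ 2 d (k - 1): each splitting costs at most 2 d, and k vertices allow at most
-- k - 1 splittings.
split-trivial : ∀ d w ℓ₁ ℓ₂ k₁ k₂ → w ℕ.≤ 2 * d →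
  ℓ₁ + 2 * d ℕ.≤ 2 * (d * k₁) → ℓ₂ + 2 * d ℕ.≤ 2 * (d * k₂) →
  (w + (ℓ₁ + ℓ₂)) + 2 * d ℕ.≤ 2 * (d * (k₁ + k₂))
split-trivial d w ℓ₁ ℓ₂ k₁ k₂ hw h₁ h₂ =
  ≤-by 0 (hw +≤ h₁ +≤ h₂) (solve (d ∷ w ∷ ℓ₁ ∷ ℓ₂ ∷ k₁ ∷ k₂ ∷ []))

split-large-large : ∀ d M w ℓ₁ ℓ₂ k₁ k₂ Ψ Ψ₁ Ψ₂ → w ℕ.≤ 2 * d → Ψ₁ + Ψ₂ ℕ.≤ Ψ + 2 * (M * w) →
  Bounded d M k₁ Ψ₁ ℓ₁ → Bounded d M k₂ Ψ₂ ℓ₂ → Bounded d M (k₁ + k₂) Ψ (w + (ℓ₁ + ℓ₂))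
split-large-large d M w ℓ₁ ℓ₂ k₁ k₂ Ψ Ψ₁ Ψ₂ hw hΨ h₁ h₂ =
  ≤-by 0 (hw +≤ 4 * M *≤ hw +≤ 2 *≤ hΨ +≤ h₁ +≤ h₂)
    (solve (d ∷ M ∷ w ∷ ℓ₁ ∷ ℓ₂ ∷ k₁ ∷ k₂ ∷ Ψ ∷ Ψ₁ ∷ Ψ₂ ∷ []))

-- The splitting together with all cuts inside the small part costs at most 2 d k₂; the drop of the
-- potential, doubled in `Bounded`, provides 4 d k₂.
split-large-small : ∀ d M w ℓ₁ ℓ₂ k₁ k₂ Ψ Ψ₁ → w ℕ.≤ 2 * d → Ψ₁ + 2 * (k₂ * d) ℕ.≤ Ψ →
  Bounded d M k₁ Ψ₁ ℓ₁ → ℓ₂ + 2 * d ℕ.≤ 2 * (d * k₂) → Bounded d M (k₁ + k₂) Ψ (w + (ℓ₁ + ℓ₂))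
split-large-small d M w ℓ₁ ℓ₂ k₁ k₂ Ψ Ψ₁ hw hΨ h₁ h₂ =
  ≤-by (2 * (k₂ * d) + 2 * (2 * M * (1 + 4 * M)) * k₂) (hw +≤ 2 *≤ hΨ +≤ h₁ +≤ h₂)
    (solve (d ∷ M ∷ w ∷ ℓ₁ ∷ ℓ₂ ∷ k₁ ∷ k₂ ∷ Ψ ∷ Ψ₁ ∷ []))

-- The total cost is at most 2 d (k₁ + k₂), which the sum of the two potential drops pays. The slack
-- is paid by the linear term, since d ≤ 2 M (k₁ + k₂).
split-small-small : ∀ d M w ℓ₁ ℓ₂ k₁ k₂ Ψ Ψ₁ Ψ₂ → w ℕ.≤ 2 * d →
  Ψ₁ + 2 * (k₂ * d) ℕ.≤ Ψ → Ψ₂ + 2 * (k₁ * d) ℕ.≤ Ψ → d ℕ.≤ 2 * M * (k₁ + k₂) →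
  ℓ₁ + 2 * d ℕ.≤ 2 * (d * k₁) → ℓ₂ + 2 * d ℕ.≤ 2 * (d * k₂) →
  Bounded d M (k₁ + k₂) Ψ (w + (ℓ₁ + ℓ₂))
split-small-small d M w ℓ₁ ℓ₂ k₁ k₂ Ψ Ψ₁ Ψ₂ hw hΨ₁ hΨ₂ hk h₁ h₂ =
  ≤-by (Ψ₁ + Ψ₂ + 2 * d) (hw +≤ hΨ₁ +≤ hΨ₂ +≤ 2 * (1 + 4 * M) *≤ hk +≤ h₁ +≤ h₂)
    (solve (d ∷ M ∷ w ∷ ℓ₁ ∷ ℓ₂ ∷ k₁ ∷ k₂ ∷ Ψ ∷ Ψ₁ ∷ Ψ₂ ∷ []))

-- Finite sums and sizes of vertex sets.

sum-mono : ∀ {n} {f g : Fin n → ℕ} → (∀ i → f i ℕ.≤ g i) → sum f ℕ.≤ sum g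
sum-mono {zero}  h = z≤n
sum-mono {suc n} h = +-mono-≤ (h zero) (sum-mono (h ∘ suc))

⟦_⟧ : Bool → ℕ
⟦ b ⟧ = if b then 1 else 0

sum-δ : ∀ {n} (v : Fin n) (f : Fin n → ℕ) → sum (λ u → ⟦ does (u ≟ v) ⟧ * f u) ≡ f v
sum-δ {suc n} zero f =
  trans (cong (_+_ (1 * f zero)) (sum-replicate-zero n)) (trans (+-identityʳ _) (+-identityʳ _))
sum-δ (suc v) f = sum-δ v (f ∘ suc)

infixr 7 _∩_ _∖_

∁ : ∀ {n} → VertexSet n → VertexSet n
∁ X v = not (X v)

_∩_ _∖_ : ∀ {n} → VertexSet n → VertexSet n → VertexSet n
(K ∩ Z) v = K v ∧ Z v
(K ∖ Z) v = K v ∧ not (Z v)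

size : ∀ {n} → VertexSet n → ℕ
size K = sum λ v → ⟦ K v ⟧

size-split : ∀ {n} (K Z : VertexSet n) → size K ≡ size (K ∩ Z) + size (K ∖ Z)
size-split {n} K Z = trans (sum-cong-≗ {n} λ v → split (K v) (Z v)) (∑-distrib-+ {n} _ _)
  where
  split : ∀ k z → ⟦ k ⟧ ≡ ⟦ k ∧ z ⟧ + ⟦ k ∧ not z ⟧
  split true true = refl
  split true false = refl
  split false _ = refl

size-positive : ∀ {n} (K : VertexSet n) v → K v ≡ true → 1 ℕ.≤ size K
size-positive K v Kv = begin
  1                                         ≡⟨ cong ⟦_⟧ Kv ⟨
  ⟦ K v ⟧                                   ≡⟨ sum-δ v (λ u → ⟦ K u ⟧) ⟨
  sum (λ u → ⟦ does (u ≟ v) ⟧ * ⟦ K u ⟧)    ≤⟨ sum-mono (λ u → below (does (u ≟ v)) ⟦ K u ⟧) ⟩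
  size K                                    ∎
  where
  open ≤-R
  below : ∀ b x → ⟦ b ⟧ * x ℕ.≤ x
  below true  x = ≤-reflexive (+-identityʳ x)
  below false x = z≤n

-- Counting edges between vertex sets.

module Cuts {n} (G : SimpleGraph n) where

  private
    variable
      K K′ X Z : VertexSet n

  e : Fin n → VertexSet n → ℕ
  e u K = sum λ v → ⟦ adj G u v ∧ K v ⟧

  -- The cut weight with each crossing edge counted from its end in `X`, which avoids the order on
  -- the vertices.
  W : VertexSet n → ℕ
  W X = sum λ u → ⟦ X u ⟧ * e u (∁ X)

  e-cong : ∀ u → (∀ v → K v ≡ K′ v) → e u K ≡ e u K′
  e-cong u h = sum-cong-≗ {n} λ v → cong (λ b → ⟦ adj G u v ∧ b ⟧) (h v)

  e-mono : ∀ u → (∀ v → K v ≡ true → K′ v ≡ true) → e u K ℕ.≤ e u K′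
  e-mono {K} {K′} u h = sum-mono λ v → mono (adj G u v) (K v) (K′ v) (h v)
    where
    mono : ∀ a k k′ → (k ≡ true → k′ ≡ true) → ⟦ a ∧ k ⟧ ℕ.≤ ⟦ a ∧ k′ ⟧
    mono false _     _ h = z≤n
    mono true  false _ h = z≤n
    mono true  true  _ h = ≤-reflexive (≡-sym (cong ⟦_⟧ (h refl)))

  e-split : ∀ u (K Z : VertexSet n) → e u K ≡ e u (K ∩ Z) + e u (K ∖ Z)
  e-split u K Z = trans (sum-cong-≗ {n} λ v → split (adj G u v) (K v) (Z v)) (∑-distrib-+ {n} _ _)
    where
    split : ∀ a k z → ⟦ a ∧ k ⟧ ≡ ⟦ a ∧ (k ∧ z) ⟧ + ⟦ a ∧ (k ∧ not z) ⟧
    split false _ _ = refl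
    split true false _ = refl
    split true true true = refl
    split true true false = refl

  e≤size : ∀ u (K : VertexSet n) → e u K ℕ.≤ size K
  e≤size u K = sum-mono λ v → below (adj G u v) (K v)
    where
    below : ∀ a k → ⟦ a ∧ k ⟧ ℕ.≤ ⟦ k ⟧
    below false _ = z≤n
    below true  _ = ≤-refl

  double-count : ∀ (P S : VertexSet n) →
    sum (λ u → ⟦ P u ⟧ * e u S) ≡ sum (λ v → ⟦ S v ⟧ * e v P)
  double-count P S = begin
    sum (λ u → ⟦ P u ⟧ * e u S)
      ≡⟨ sum-cong-≗ {n} (λ u → *-distribˡ-sum {n} ⟦ P u ⟧ _) ⟩
    sum (λ u → sum λ v → ⟦ P u ⟧ * ⟦ adj G u v ∧ S v ⟧)
      ≡⟨ ∑-comm (λ u v → ⟦ P u ⟧ * ⟦ adj G u v ∧ S v ⟧) ⟩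
    sum (λ v → sum λ u → ⟦ P u ⟧ * ⟦ adj G u v ∧ S v ⟧)
      ≡⟨ sum-cong-≗ {n} (λ v → sum-cong-≗ {n} λ u → swap (P u) (S v) (sym G u v)) ⟩
    sum (λ v → sum λ u → ⟦ S v ⟧ * ⟦ adj G v u ∧ P u ⟧)
      ≡⟨ sum-cong-≗ {n} (λ v → *-distribˡ-sum {n} ⟦ S v ⟧ _) ⟨
    sum (λ v → ⟦ S v ⟧ * e v P) ∎
    where
    open ≡-Reasoning
    swap : ∀ p s {a b} → a ≡ b → ⟦ p ⟧ * ⟦ a ∧ s ⟧ ≡ ⟦ s ⟧ * ⟦ b ∧ p ⟧
    swap true  true  refl = refl
    swap true  false {false} refl = refl
    swap true  false {true} refl = refl
    swap false true  {false} refl = refl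
    swap false true  {true} refl = refl
    swap false false refl = refl

  W-∁ : ∀ X → W (∁ X) ≡ W X
  W-∁ X = trans
    (sum-cong-≗ {n} λ u → cong (⟦ not (X u) ⟧ *_) (e-cong u λ v → not-involutive (X v)))
    (double-count (∁ X) X)

  -- A crossing pair i < j is oriented away from its end in `X`. Exchanging the sums in one of the
  -- two orientations leaves every ordered pair counted once; the diagonal vanishes by `irrefl`.
  cutWeight≡W : ∀ X → cutWeight G X ≡ W X
  cutWeight≡W X = begin
    cutWeight G X
      ≡⟨ trans (sum-allFin {n} _) (sum-cong-≗ {n} λ i → sum-allFin {n} _) ⟩
    sum (λ i → sum λ j → ⟦ lt i j ∧ (adj G i j ∧ (X i xor X j)) ⟧)
      ≡⟨ sum-cong-≗ {n} (λ i → trans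
           (sum-cong-≗ {n} λ j → orient (lt i j) (X i) (X j) (sym G i j)) (∑-distrib-+ {n} _ _)) ⟩
    sum (λ i → sum (λ j → ⟦ lt i j ⟧ * w i j) + sum (λ j → ⟦ lt i j ⟧ * w j i))
      ≡⟨ ∑-distrib-+ {n} _ _ ⟩
    sum (λ i → sum λ j → ⟦ lt i j ⟧ * w i j) + sum (λ i → sum λ j → ⟦ lt i j ⟧ * w j i)
      ≡⟨ cong (_+_ _) (∑-comm (λ i j → ⟦ lt i j ⟧ * w j i)) ⟩
    sum (λ i → sum λ j → ⟦ lt i j ⟧ * w i j) + sum (λ i → sum λ j → ⟦ lt j i ⟧ * w i j)
      ≡⟨ ∑-distrib-+ {n} _ _ ⟨
    sum (λ i → sum (λ j → ⟦ lt i j ⟧ * w i j) + sum (λ j → ⟦ lt j i ⟧ * w i j))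
      ≡⟨ sum-cong-≗ {n} (λ i → trans (≡-sym (∑-distrib-+ {n} _ _)) (sum-cong-≗ {n} λ j → total i j)) ⟩
    sum (λ i → sum λ j → w i j)
      ≡⟨ sum-cong-≗ {n} (λ i → *-distribˡ-sum {n} ⟦ X i ⟧ _) ⟨
    W X ∎
    where
    open ≡-Reasoning
    lt : Fin n → Fin n → Bool
    lt i j = ⌊ i <? j ⌋

    w : Fin n → Fin n → ℕ
    w i j = ⟦ X i ⟧ * ⟦ adj G i j ∧ not (X j) ⟧

    sum-allFin : ∀ {m} (f : Fin m → ℕ) → ListAction.sum (map f (allFin m)) ≡ sum f
    sum-allFin f = trans (cong ListAction.sum (map-tabulate (λ i → i) f)) (go f)
      where
      go : ∀ {m} (f : Fin m → ℕ) → ListAction.sum (tabulate f) ≡ sum f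
      go {zero}  f = refl
      go {suc m} f = cong (_+_ (f zero)) (go (f ∘ suc))

    orient : ∀ l x y {a b} → a ≡ b → ⟦ l ∧ (a ∧ (x xor y)) ⟧
           ≡ ⟦ l ⟧ * (⟦ x ⟧ * ⟦ a ∧ not y ⟧) + ⟦ l ⟧ * (⟦ y ⟧ * ⟦ b ∧ not x ⟧)
    orient false _     _     refl = refl
    orient true  true  true  {false} refl = refl
    orient true  true  true  {true}  refl = refl
    orient true  true  false {false} refl = refl
    orient true  true  false {true}  refl = refl
    orient true  false true  {false} refl = refl
    orient true  false true  {true}  refl = refl
    orient true  false false {false} refl = refl
    orient true  false false {true}  refl = refl

    total : ∀ i j → ⟦ lt i j ⟧ * w i j + ⟦ lt j i ⟧ * w i j ≡ w i j
    total i j with i <? j | j <? i | <-cmp i j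
    ... | yes _ | no _  | _ = trans (+-identityʳ _) (+-identityʳ _)
    ... | no _  | yes _ | _ = +-identityʳ _
    ... | yes _ | yes q | tri< _ _ ¬q = ⊥-elim (¬q q)
    ... | yes p | yes _ | tri≈ ¬p _ _ = ⊥-elim (¬p p)
    ... | yes p | yes _ | tri> ¬p _ _ = ⊥-elim (¬p p)
    ... | no ¬p | no _  | tri< p _ _ = ⊥-elim (¬p p)
    ... | no _  | no ¬q | tri> _ _ q = ⊥-elim (¬q q)
    ... | no _  | no _  | tri≈ _ refl _ =
      ≡-sym (trans (cong (λ a → ⟦ X i ⟧ * ⟦ a ∧ not (X i) ⟧) (irrefl G i)) (*-zeroʳ ⟦ X i ⟧))

  remove : VertexSet n → Fin n → VertexSet n
  remove Z v u = Z u ∧ not (does (u ≟ v))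

  -- The edges from `v` to the complement leave the cut, and only edges from `v` to `Z` can enter
  -- it.
  W-remove : ∀ Z v → Z v ≡ true → W (remove Z v) + e v (∁ Z) ℕ.≤ W Z + e v Z
  W-remove Z v Zv = begin
    W Y + e v (∁ Z)
      ≡⟨ cong (_+_ (W Y)) (sum-δ v (λ u → e u (∁ Z))) ⟨
    W Y + sum (λ u → ⟦ does (u ≟ v) ⟧ * e u (∁ Z))
      ≡⟨ ∑-distrib-+ {n} _ _ ⟨
    sum (λ u → ⟦ Y u ⟧ * e u (∁ Y) + ⟦ does (u ≟ v) ⟧ * e u (∁ Z))
      ≤⟨ sum-mono (λ u → term u (u ≟ v)) ⟩
    sum (λ u → ⟦ Z u ⟧ * e u (∁ Z) + ⟦ adj G v u ∧ Z u ⟧)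
      ≡⟨ ∑-distrib-+ {n} _ _ ⟩
    W Z + e v Z ∎
    where
    open ≤-R
    Y = remove Z v

    e-∁Y : ∀ u → e u (∁ Y) ℕ.≤ e u (∁ Z) + ⟦ adj G u v ⟧
    e-∁Y u = begin
      e u (∁ Y)
        ≤⟨ sum-mono (λ x → bound (adj G u x) (Z x) (does (x ≟ v))) ⟩
      sum (λ x → ⟦ adj G u x ∧ not (Z x) ⟧ + ⟦ does (x ≟ v) ⟧ * ⟦ adj G u x ⟧)
        ≡⟨ ∑-distrib-+ {n} _ _ ⟩
      e u (∁ Z) + sum (λ x → ⟦ does (x ≟ v) ⟧ * ⟦ adj G u x ⟧)
        ≡⟨ cong (_+_ (e u (∁ Z))) (sum-δ v (λ x → ⟦ adj G u x ⟧)) ⟩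
      e u (∁ Z) + ⟦ adj G u v ⟧ ∎
      where
      bound : ∀ a z b → ⟦ a ∧ not (z ∧ not b) ⟧ ℕ.≤ ⟦ a ∧ not z ⟧ + ⟦ b ⟧ * ⟦ a ⟧
      bound false _     _     = z≤n
      bound true  false _     = s≤s z≤n
      bound true  true  true  = s≤s z≤n
      bound true  true  false = z≤n

    split : ∀ z b a x y → y ℕ.≤ x + ⟦ a ⟧ → ⟦ z ∧ true ⟧ * y + 0 * b ℕ.≤ ⟦ z ⟧ * x + ⟦ a ∧ z ⟧
    split false b a x y h = z≤n
    split true  b true x y h = ≤-by 0 h (solve (b ∷ x ∷ y ∷ []))
    split true  b false x y h = ≤-by 0 h (solve (b ∷ x ∷ y ∷ []))

    term : ∀ u (q : Dec (u ≡ v)) → ⟦ Z u ∧ not (does q) ⟧ * e u (∁ Y) + ⟦ does q ⟧ * e u (∁ Z)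
                                ℕ.≤ ⟦ Z u ⟧ * e u (∁ Z) + ⟦ adj G v u ∧ Z u ⟧
    term u (yes refl) rewrite Zv = m≤m+n _ _
    term u (no _) rewrite sym G v u = split (Z u) (e u (∁ Z)) (adj G u v) _ _ (e-∁Y u)

-- Near-mincuts and the potential.

double-bound : ∀ p d w → (1 + p) * w ℕ.≤ (1 + 2 * p) * d → (1 + p) * w ℕ.≤ (1 + p) * (2 * d)
double-bound p d w h = ≤-by d h (solve (p ∷ w ∷ d ∷ []))

-- The contribution of one vertex u to `Ψ-split`: its edges to the new part on the other side of `Z`
-- lie in the cut, and if u is outside `K`, the old term pays for the new part on its own side.
split-term : ∀ M k z {x y w i o} → x ℕ.≤ w → y ℕ.≤ w → x ℕ.≤ M * i → y ℕ.≤ M * o →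
  ⟦ not (k ∧ z) ⟧ * x + ⟦ not (k ∧ not z) ⟧ * y
  ℕ.≤ ⟦ not k ⟧ * w + (M * (⟦ z ⟧ * o) + M * (⟦ not z ⟧ * i))
split-term M true  true  {x} {y} {w} {i} {o} _ _ _ hy = ≤-by 0 hy (solve (M ∷ y ∷ o ∷ []))
split-term M true  false {x} {y} {w} {i} {o} _ _ hx _ = ≤-by 0 hx (solve (M ∷ x ∷ i ∷ []))
split-term M false true  {x} {y} {w} {i} {o} hx _ _ hy =
  ≤-by 0 (hx +≤ hy) (solve (M ∷ x ∷ y ∷ w ∷ o ∷ []))
split-term M false false {x} {y} {w} {i} {o} _ hy hx _ =
  ≤-by 0 (hx +≤ hy) (solve (M ∷ x ∷ y ∷ w ∷ i ∷ []))

-- The contribution of one vertex to `Ψ-peel`. A vertex of K ∩ Z is counted for the first time and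
-- costs at most d²; one of Z ∖ K brings the gain; one of K ∖ Z is not counted; for the others,
-- monotonicity suffices.
weighted-term : ∀ d M c k z {x y a o} → x ℕ.≤ d → x ℕ.≤ y → d * x + M * d * a ℕ.≤ d * y + c * o →
  d * (⟦ not (k ∧ not z) ⟧ * x) + M * d * (⟦ z ∧ not k ⟧ * a)
  ℕ.≤ d * (⟦ not k ⟧ * y) + c * (⟦ z ⟧ * o) + d * d * ⟦ k ∧ z ⟧
weighted-term d M c true true {x} {y} {a} {o} hx _ _ =
  ≤-by (c * o) (d *≤ hx) (solve (d ∷ M ∷ c ∷ x ∷ o ∷ []))
weighted-term d M c true false _ _ _ =
  ≤-trans (≤-reflexive (cong₂ _+_ (*-zeroʳ d) (*-zeroʳ (M * d)))) z≤n
weighted-term d M c false true {x} {y} {a} {o} _ _ h =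
  ≤-by 0 h (solve (d ∷ M ∷ c ∷ x ∷ y ∷ a ∷ o ∷ []))
weighted-term d M c false false {x} {y} _ hxy _ =
  ≤-by 0 (d *≤ hxy) (solve (d ∷ M ∷ c ∷ x ∷ y ∷ []))

inner-term : ∀ d Q s x b → (b ≡ true → d ℕ.≤ Q * (s + x)) →
  ⟦ b ⟧ * d ℕ.≤ Q * (⟦ b ⟧ * x) + ⟦ b ⟧ * (Q * s)
inner-term d Q s x false _ = z≤n
inner-term d Q s x true  f = ≤-by 0 (f refl) (solve (d ∷ Q ∷ s ∷ x ∷ []))

*-rotate : ∀ s q → q * (s * s) ≡ s * (q * s)
*-rotate s q = solve (s ∷ q ∷ [])

≥8m²-nonZero : ∀ {d} m → 1 ℕ.≤ m → 8 * m * m ℕ.≤ d → ℕ.NonZero d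
≥8m²-nonZero (suc _) _ (s≤s _) = _

-- The ratio α enters only through p, where α ≤ (1 + 2p) / (1 + p).
module NearCuts {n} (G : SimpleGraph n) (p d : ℕ)
                (min-degree : ∀ v → d ℕ.≤ Cuts.e G v (λ _ → true)) where

  open Cuts G

  -- A vertex has at least d / Q neighbours on its own side of a near cut. The factor 4 in `M` makes
  -- the gain in `peel-arith` exceed the losses.
  Q M : ℕ
  Q = 2 * (1 + p)
  M = 4 * Q

  -- Denominators are cleared. Non-triviality is stated as a companion for every vertex, so that
  -- moving any single vertex leaves both sides nonempty.
  record NearCut (Z : VertexSet n) : Set where
    field
      nontrivial   : ∀ v → ∃ λ u → u ≢ v × Z u ≡ Z v
      below-degree : (1 + p) * W Z ℕ.≤ (1 + 2 * p) * d
      below-cuts   : ∀ Y → IsCut Y → (1 + p) * W Z ℕ.≤ (1 + 2 * p) * W Y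
  open NearCut

  NearCut-∁ : ∀ {Z} → NearCut Z → NearCut (∁ Z)
  NearCut-∁ {Z} h .nontrivial v with nontrivial h v
  ... | u , u≢v , eq = u , u≢v , cong not eq
  NearCut-∁ {Z} h .below-degree rewrite W-∁ Z = below-degree h
  NearCut-∁ {Z} h .below-cuts rewrite W-∁ Z = below-cuts h

  W≤2d : ∀ {Z} → NearCut Z → W Z ℕ.≤ 2 * d
  W≤2d {Z} h = *-cancelˡ-≤ (1 + p) (double-bound p d (W Z) (below-degree h))

  own-side-degree : ∀ {Z} → NearCut Z → ∀ v → Z v ≡ true → d ℕ.≤ Q * e v Z
  own-side-degree {Z} h v Zv =
    flip-bound p d (W Z) (W (remove Z v)) (e v Z) (e v (∁ Z))
      (below-degree h) (below-cuts h (remove Z v) cut) (W-remove Z v Zv)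
      (≤-trans (min-degree v) (≤-reflexive (e-split v (λ _ → true) Z)))
    where
    cut : IsCut (remove Z v)
    cut with nontrivial h v
    ... | u , u≢v , eq =
      (u , cong₂ (λ z b → z ∧ not b) (trans eq Zv) (dec-false (u ≟ v) u≢v)) ,
      (v , cong₂ (λ z b → z ∧ not b) Zv (dec-true (v ≟ v) refl))

  ψ : VertexSet n → Fin n → ℕ
  ψ K u = d ⊓ (M * e u K)

  Ψ : VertexSet n → ℕ
  Ψ K = sum λ u → ⟦ not (K u) ⟧ * ψ K u

  Ψ-cong : ∀ {K K′} → (∀ v → K v ≡ K′ v) → Ψ K ≡ Ψ K′
  Ψ-cong h = sum-cong-≗ {n} λ u →
    cong₂ (λ b x → ⟦ not b ⟧ * (d ⊓ (M * x))) (h u) (e-cong u h)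

  ψ-mono : ∀ {K K′} u → (∀ v → K v ≡ true → K′ v ≡ true) → ψ K u ℕ.≤ ψ K′ u
  ψ-mono u h = ⊓-mono-≤ (≤-refl {d}) (M *≤ e-mono u h)

  ψ≤e : ∀ {K K′} u → (∀ v → K v ≡ true → K′ v ≡ true) → ψ K u ℕ.≤ M * e u K′
  ψ≤e u h = ≤-trans (m⊓n≤n d _) (M *≤ e-mono u h)

  ∧-left : ∀ {a b} → a ∧ b ≡ true → a ≡ true
  ∧-left {true} _ = refl

  ∧-right : ∀ {a b} → a ∧ b ≡ true → b ≡ true
  ∧-right {true} h = h

  Ψ-split : ∀ K Z → Ψ (K ∩ Z) + Ψ (K ∖ Z) ℕ.≤ Ψ K + 2 * (M * W Z)
  Ψ-split K Z = begin
    Ψ (K ∩ Z) + Ψ (K ∖ Z)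
      ≡⟨ ∑-distrib-+ {n} _ _ ⟨
    sum (λ u → ⟦ not (K u ∧ Z u) ⟧ * ψ (K ∩ Z) u + ⟦ not (K u ∧ not (Z u)) ⟧ * ψ (K ∖ Z) u)
      ≤⟨ sum-mono (λ u → split-term M (K u) (Z u)
           (ψ-mono u λ _ → ∧-left) (ψ-mono u λ _ → ∧-left)
           (ψ≤e u λ _ → ∧-right) (ψ≤e u λ _ → ∧-right)) ⟩
    sum (λ u → ⟦ not (K u) ⟧ * ψ K u + (M * (⟦ Z u ⟧ * e u (∁ Z)) + M * (⟦ not (Z u) ⟧ * e u Z)))
      ≡⟨ trans (∑-distrib-+ {n} _ _) (cong (_+_ (Ψ K)) (∑-distrib-+ {n} _ _)) ⟩
    Ψ K + (sum (λ u → M * (⟦ Z u ⟧ * e u (∁ Z))) + sum (λ u → M * (⟦ not (Z u) ⟧ * e u Z)))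
      ≡⟨ cong (_+_ (Ψ K)) (cong₂ _+_ (*-distribˡ-sum {n} M _) (*-distribˡ-sum {n} M _)) ⟨
    Ψ K + (M * W Z + M * sum (λ u → ⟦ not (Z u) ⟧ * e u Z))
      -- The sum over the complement counts the same cut edges from their other ends, whence the
      -- factor 2.
      ≡⟨ cong (λ w → Ψ K + (M * W Z + M * w)) (double-count (∁ Z) Z) ⟩
    Ψ K + (M * W Z + M * W Z)
      ≡⟨ cong (λ w → Ψ K + (M * W Z + w)) (+-identityʳ (M * W Z)) ⟨
    Ψ K + 2 * (M * W Z) ∎
    where open ≤-R

  Ψ-peel : ∀ {Z} K → NearCut Z → 2 * M * size (K ∩ Z) ℕ.≤ d → 8 * M * M ℕ.≤ d →
           Ψ (K ∖ Z) + 2 * (size (K ∩ Z) * d) ℕ.≤ Ψ K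
  Ψ-peel {Z} K h hs hd = peel-arith d Q M s T (W Z) (Ψ K) (Ψ R) refl weighted (W≤2d h) inner hs hd
    where
    open ≤-R
    instance d≢0 = ≥8m²-nonZero M (s≤s z≤n) hd
    S = K ∩ Z
    R = K ∖ Z
    s = size S
    -- The number of edges between `S` and Z ∖ K, which are the source of the gain.
    T = sum λ u → ⟦ Z u ∧ not (K u) ⟧ * e u S
    c = 2 * M * (M * s)

    core : ∀ u → d * ψ R u + M * d * e u S ℕ.≤ d * ψ K u + c * e u (∁ Z)
    core u = begin
      d * ψ R u + M * d * e u S
        ≤⟨ peel-term d M s (e u S) (e u R) hs (e≤size u S) ⟩
      d * (d ⊓ (M * (e u S + e u R))) + c * e u R
        ≡⟨ cong (λ x → d * (d ⊓ (M * x)) + c * e u R) (e-split u K Z) ⟨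
      d * ψ K u + c * e u R
        -- `R` lies outside `Z`, so summing the truncation error over the vertices of `Z` yields at
        -- most c times `W Z`.
        ≤⟨ ≤-refl {d * ψ K u} +≤ c *≤ e-mono {R} {∁ Z} u (λ _ → ∧-right) ⟩
      d * ψ K u + c * e u (∁ Z) ∎

    weighted : d * Ψ R + M * d * T ℕ.≤ d * Ψ K + c * W Z + d * d * s
    weighted = begin
      d * Ψ R + M * d * T
        ≡⟨ trans (cong₂ _+_ (*-distribˡ-sum {n} d _) (*-distribˡ-sum {n} (M * d) _))
                 (≡-sym (∑-distrib-+ {n} _ _)) ⟩
      sum (λ u → d * (⟦ not (K u ∧ not (Z u)) ⟧ * ψ R u) + M * d * (⟦ Z u ∧ not (K u) ⟧ * e u S))
        ≤⟨ sum-mono (λ u → weighted-term d M c (K u) (Z u) (m⊓n≤m d _)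
             (ψ-mono {R} {K} u λ _ → ∧-left) (core u)) ⟩
      sum (λ u → d * (⟦ not (K u) ⟧ * ψ K u) + c * (⟦ Z u ⟧ * e u (∁ Z)) + d * d * ⟦ K u ∧ Z u ⟧)
        ≡⟨ trans (∑-distrib-+ {n} _ _) (cong₂ _+_ (∑-distrib-+ {n} _ _) refl) ⟩
      sum (λ u → d * (⟦ not (K u) ⟧ * ψ K u)) + sum (λ u → c * (⟦ Z u ⟧ * e u (∁ Z)))
        + sum (λ u → d * d * ⟦ K u ∧ Z u ⟧)
        ≡⟨ cong₂ _+_ (cong₂ _+_ (*-distribˡ-sum {n} d _) (*-distribˡ-sum {n} c _))
                     (*-distribˡ-sum {n} (d * d) _) ⟨
      d * Ψ K + c * W Z + d * d * s ∎

    P = Z ∖ K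

    -- Of the neighbours that `v` has in `Z`, at most `s` lie in `S`; the others lie in Z ∖ K.
    own : ∀ v → K v ∧ Z v ≡ true → d ℕ.≤ Q * (s + e v P)
    own v Sv = ≤-trans (own-side-degree h v (∧-right Sv)) (Q *≤ (begin
      e v Z                 ≡⟨ e-split v Z K ⟩
      e v (Z ∩ K) + e v P   ≡⟨ cong (_+ e v P) (e-cong v (λ x → ∧-comm (Z x) (K x))) ⟩
      e v S + e v P         ≤⟨ e≤size v S +≤ ≤-refl ⟩
      s + e v P             ∎))

    inner : s * d ℕ.≤ Q * T + Q * (s * s)
    inner = begin
      s * d
        ≡⟨ *-distribʳ-sum {n} d _ ⟩
      sum (λ v → ⟦ S v ⟧ * d)
        ≤⟨ sum-mono (λ v → inner-term d Q s (e v P) (S v) (own v)) ⟩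
      sum (λ v → Q * (⟦ S v ⟧ * e v P) + ⟦ S v ⟧ * (Q * s))
        ≡⟨ ∑-distrib-+ {n} _ _ ⟩
      sum (λ v → Q * (⟦ S v ⟧ * e v P)) + sum (λ v → ⟦ S v ⟧ * (Q * s))
        ≡⟨ cong₂ _+_ (*-distribˡ-sum {n} Q _) (*-distribʳ-sum {n} (Q * s) _) ⟨
      Q * sum (λ v → ⟦ S v ⟧ * e v P) + s * (Q * s)
        ≡⟨ cong₂ _+_ (cong (Q *_) (double-count P S)) (*-rotate s Q) ⟨
      Q * T + Q * (s * s) ∎

-- Recursive splitting and a cover by linearly many edges.

sparse-bound : ∀ d M k Ψ → d ℕ.≤ 2 * M * k → Bounded d M k Ψ 0
sparse-bound d M k Ψ h = ≤-by (2 * Ψ) (2 * (1 + 4 * M) *≤ h) (solve (d ∷ M ∷ k ∷ Ψ ∷ []))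

⌊⌋-true : ∀ {A : Set} (q : Dec A) → A → ⌊ q ⌋ ≡ true
⌊⌋-true (yes _) _ = refl
⌊⌋-true (no ¬a) a = ⊥-elim (¬a a)

xor-cases : ∀ x y → x xor y ≡ true → (x ≡ true × y ≡ false) ⊎ (x ≡ false × y ≡ true)
xor-cases true  false _ = inj₁ (refl , refl)
xor-cases false true  _ = inj₂ (refl , refl)

length-concatMap : ∀ {A B : Set} (f : A → List B) xs →
  length (concatMap f xs) ≡ ListAction.sum (map (λ x → length (f x)) xs)
length-concatMap f []       = refl
length-concatMap f (x ∷ xs) = trans (length-++ (f x)) (cong (_+_ (length (f x))) (length-concatMap f xs))

-- Follows the summand of `cutWeight`, so that the length of `cutEdges` is the cut weight.
cutPair : ∀ {n} → SimpleGraph n → VertexSet n → Fin n → Fin n → List (Fin n × Fin n)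
cutPair G X i j = if ⌊ i <? j ⌋ ∧ adj G i j ∧ crosses X i j then (i , j) ∷ [] else []

cutEdges : ∀ {n} → SimpleGraph n → VertexSet n → List (Fin n × Fin n)
cutEdges {n} G X = concatMap (λ i → concatMap (cutPair G X i) (allFin n)) (allFin n)

length-cutEdges : ∀ {n} (G : SimpleGraph n) X → length (cutEdges G X) ≡ cutWeight G X
length-cutEdges {n} G X =
  trans (length-concatMap _ (allFin n)) (cong ListAction.sum (map-cong (λ i →
    trans (length-concatMap _ (allFin n)) (cong ListAction.sum (map-cong (λ j →
      length-if (⌊ i <? j ⌋ ∧ adj G i j ∧ crosses X i j)) (allFin n)))) (allFin n)))
  where
  length-if : ∀ {A : Set} b {x : A} → length (if b then x ∷ [] else []) ≡ (if b then 1 else 0)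
  length-if true  = refl
  length-if false = refl

∈-cutEdges : ∀ {n} (G : SimpleGraph n) X i j → i Fin.< j → adj G i j ≡ true →
  crosses X i j ≡ true → (i , j) ∈ cutEdges G X
∈-cutEdges G X i j i<j a x =
  ∈-concatMap⁺ (λ i → concatMap (cutPair G X i) (allFin _)) (lose (∈-allFin i)
    (∈-concatMap⁺ (cutPair G X i) (lose (∈-allFin j)
      (∈-if (cong₂ _∧_ (⌊⌋-true (i <? j) i<j) (cong₂ _∧_ a x))))))
  where
  ∈-if : ∀ {A : Set} {b} {x : A} → b ≡ true → x ∈ (if b then x ∷ [] else [])
  ∈-if refl = here refl

module Cover {n} (G : SimpleGraph n) (p d : ℕ)
             (min-degree : ∀ v → d ℕ.≤ Cuts.e G v (λ _ → true))
             {k} (X : Fin k → VertexSet n) (U : Fin k → Set) (U? : ∀ t → Dec (U t))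
             (near : ∀ t → U t → NearCuts.NearCut G p d min-degree (X t)) where

  open Cuts G
  open NearCuts G p d min-degree

  Separated : VertexSet n → Set
  Separated K = ∃ λ t → U t × ∃₂ λ i j → (K i ≡ true × K j ≡ true) × (X t i ≡ true × X t j ≡ false)

  separated? : ∀ K → Dec (Separated K)
  separated? K = any? λ t → U? t ×-dec any? λ i → any? λ j →
    ((K i 𝔹.≟ true) ×-dec (K j 𝔹.≟ true)) ×-dec ((X t i 𝔹.≟ true) ×-dec (X t j 𝔹.≟ false))

  Covers : VertexSet n → List (Fin n × Fin n) → Set
  Covers K L = ∀ t → U t → ∀ i j → i Fin.< j → adj G i j ≡ true →
    K i ≡ true → K j ≡ true → crosses (X t) i j ≡ true → (i , j) ∈ L

  -- The first bound serves small parts and small `d`; the second, through the potential, serves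
  -- large parts once `d` exceeds a constant. The recursion carries both because a large part may
  -- split into small ones.
  SmallCover : VertexSet n → Set
  SmallCover K = ∃ λ L → Covers K L ×
    (length L + 2 * d ℕ.≤ 2 * (d * size K)) ×
    (8 * M * M ℕ.≤ d → d ℕ.< 2 * M * size K → Bounded d M (size K) (Ψ K) (length L))

  combine : ∀ K Z → NearCut Z → SmallCover (K ∩ Z) → SmallCover (K ∖ Z) → SmallCover K
  combine K Z hZ (L₁ , c₁ , t₁ , b₁) (L₂ , c₂ , t₂ , b₂) = L , covers , trivial , bounded
    where
    L = cutEdges G Z ++ (L₁ ++ L₂)
    w  = W Z
    ℓ₁ = length L₁
    ℓ₂ = length L₂
    k₁ = size (K ∩ Z)
    k₂ = size (K ∖ Z)

    covers : Covers K L
    covers t Ut i j i<j a Ki Kj x with Z i in Zi | Z j in Zj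
    ... | true  | true  = ∈-++⁺ʳ (cutEdges G Z) (∈-++⁺ˡ
      (c₁ t Ut i j i<j a (cong₂ _∧_ Ki Zi) (cong₂ _∧_ Kj Zj) x))
    ... | false | false = ∈-++⁺ʳ (cutEdges G Z) (∈-++⁺ʳ L₁
      (c₂ t Ut i j i<j a (cong₂ (λ k z → k ∧ not z) Ki Zi) (cong₂ (λ k z → k ∧ not z) Kj Zj) x))
    ... | true  | false = ∈-++⁺ˡ (∈-cutEdges G Z i j i<j a (cong₂ _xor_ Zi Zj))
    ... | false | true  = ∈-++⁺ˡ (∈-cutEdges G Z i j i<j a (cong₂ _xor_ Zi Zj))

    len : length L ≡ w + (ℓ₁ + ℓ₂)
    len = trans (length-++ (cutEdges G Z))
      (cong₂ _+_ (trans (length-cutEdges G Z) (cutWeight≡W Z)) (length-++ L₁))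

    hw : w ℕ.≤ 2 * d
    hw = W≤2d hZ

    trivial : length L + 2 * d ℕ.≤ 2 * (d * size K)
    trivial rewrite len | size-split K Z = split-trivial d w ℓ₁ ℓ₂ k₁ k₂ hw t₁ t₂

    bounded : 8 * M * M ℕ.≤ d → d ℕ.< 2 * M * size K → Bounded d M (size K) (Ψ K) (length L)
    bounded hd hk rewrite len | size-split K Z
      with 2 * M * k₁ ≤? d | 2 * M * k₂ ≤? d
    ... | no h₁ | no h₂ =
      split-large-large d M w ℓ₁ ℓ₂ k₁ k₂ (Ψ K) (Ψ (K ∩ Z)) (Ψ (K ∖ Z)) hw (Ψ-split K Z)
        (b₁ hd (≰⇒> h₁)) (b₂ hd (≰⇒> h₂))
    ... | yes h₁ | no h₂ =
      subst₂ (λ k ℓ → Bounded d M k (Ψ K) (w + ℓ)) (+-comm k₂ k₁) (+-comm ℓ₂ ℓ₁)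
        (split-large-small d M w ℓ₂ ℓ₁ k₂ k₁ (Ψ K) (Ψ (K ∖ Z)) hw (Ψ-peel K hZ h₁ hd)
          (b₂ hd (≰⇒> h₂)) t₁)
    -- Now K ∖ Z is peeled off, so the complement of `Z` plays the role of the near cut. Its
    -- remainder K ∖ ∁ Z agrees with K ∩ Z only pointwise.
    ... | no h₁ | yes h₂ =
      split-large-small d M w ℓ₁ ℓ₂ k₁ k₂ (Ψ K) (Ψ (K ∖ ∁ Z)) hw (Ψ-peel K (NearCut-∁ hZ) h₂ hd)
        (subst (λ x → Bounded d M k₁ x ℓ₁) (Ψ-cong λ v → cong (K v ∧_) (≡-sym (not-involutive (Z v))))
          (b₁ hd (≰⇒> h₁))) t₂
    ... | yes h₁ | yes h₂ =
      split-small-small d M w ℓ₁ ℓ₂ k₁ k₂ (Ψ K) (Ψ (K ∖ ∁ Z)) (Ψ (K ∖ Z)) hw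
        (Ψ-peel K (NearCut-∁ hZ) h₂ hd) (Ψ-peel K hZ h₁ hd) (<⇒≤ hk) t₁ t₂

  -- Recursion on a bound for the size: a separating cut leaves a vertex in each new part, so both
  -- are smaller. Without one, no relevant cut crosses an edge inside `K`, and the empty list
  -- covers.
  small-cover : ∀ fuel K → size K ℕ.≤ fuel → ∀ v → K v ≡ true → SmallCover K
  small-cover zero K hf v Kv with () ← ≤-trans (size-positive K v Kv) hf
  small-cover (suc fuel) K hf v Kv with separated? K
  ... | no ¬sep = [] , covers ,
    (2 *≤ ≤-trans (≤-reflexive (≡-sym (*-identityʳ d))) (d *≤ size-positive K v Kv)) ,
    λ _ hk → sparse-bound d M (size K) (Ψ K) (<⇒≤ hk)
    where
    covers : Covers K []
    covers t Ut i j _ _ Ki Kj x with xor-cases (X t i) (X t j) x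
    ... | inj₁ (xi , xj) = ⊥-elim (¬sep (t , Ut , i , j , (Ki , Kj) , xi , xj))
    ... | inj₂ (xi , xj) = ⊥-elim (¬sep (t , Ut , j , i , (Kj , Ki) , xj , xi))
  ... | yes (t , Ut , i , j , (Ki , Kj) , Xi , Xj) =
    combine K Z (near t Ut)
      (small-cover fuel (K ∩ Z) (pred (+-comm-≤ sizes (size-positive (K ∖ Z) j out))) i inn)
      (small-cover fuel (K ∖ Z) (pred (≤-trans (size-positive (K ∩ Z) i inn +≤ ≤-refl) sizes)) j out)
    where
    Z = X t
    inn : (K ∩ Z) i ≡ true
    inn = cong₂ _∧_ Ki Xi
    out : (K ∖ Z) j ≡ true
    out = cong₂ (λ a b → a ∧ not b) Kj Xj
    sizes : size (K ∩ Z) + size (K ∖ Z) ℕ.≤ suc fuel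
    sizes = ≤-trans (≤-reflexive (≡-sym (size-split K Z))) hf
    pred : ∀ {a b} → suc a ℕ.≤ suc b → a ℕ.≤ b
    pred (s≤s h) = h
    +-comm-≤ : ∀ {a b c} → a + b ℕ.≤ c → 1 ℕ.≤ b → 1 + a ℕ.≤ c
    +-comm-≤ {a} {b} h hb = ≤-trans (hb +≤ ≤-refl {a}) (≤-trans (≤-reflexive (+-comm b a)) h)

  size-full : ∀ m → size {m} (λ _ → true) ≡ m
  size-full zero    = refl
  size-full (suc m) = cong suc (size-full m)

  -- For d < 8 M² the trivial bound 2 d n is already linear. Otherwise the whole vertex set is a
  -- large part, as d ≤ n, and its potential is 0 because no vertex lies outside.
  linear-cover : Fin n → ∃ λ L → Covers (λ _ → true) L × length L ℕ.≤ (4 * M + 16 * M * M) * n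
  linear-cover v with small-cover (size V) V ≤-refl v refl
    where V = λ _ → true
  ... | L , c , t , b rewrite size-full n = L , c , bound (8 * M * M ≤? d)
    where
    bound : Dec (8 * M * M ℕ.≤ d) → length L ℕ.≤ (4 * M + 16 * M * M) * n
    bound (no d<) = step d M n (length L) (<⇒≤ (≰⇒> d<)) t
      where
      step : ∀ d m n ℓ → d ℕ.≤ 8 * m * m → ℓ + 2 * d ℕ.≤ 2 * (d * n) → ℓ ℕ.≤ (4 * m + 16 * m * m) * n
      step d m n ℓ hd h = ≤-by (2 * d + 4 * m * n) (2 * n *≤ hd +≤ h) (solve (d ∷ m ∷ n ∷ ℓ ∷ []))
    bound (yes hd) = step d M n (length L) (subst (λ x → Bounded d M n x (length L))
      (sum-replicate-zero n) (b hd (≤-trans (s≤s d≤n) (large v))))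
      where
      step : ∀ d m n ℓ → Bounded d m n 0 ℓ → ℓ ℕ.≤ (4 * m + 16 * m * m) * n
      step d m n ℓ h = ≤-by (2 * (d * (1 + 4 * m))) h (solve (d ∷ m ∷ n ∷ ℓ ∷ []))
      d≤n : d ℕ.≤ n
      d≤n = ≤-trans (min-degree v) (≤-trans (e≤size v (λ _ → true)) (≤-reflexive (size-full n)))
      large : ∀ {n} → Fin n → n ℕ.< 2 * M * n
      large {suc n} _ = double M n (s≤s z≤n)
        where
        double : ∀ m n → 1 ℕ.≤ m → suc n ℕ.< 2 * m * suc n
        double m n h = ≤-by n (2 * suc n *≤ h) (solve (m ∷ n ∷ []))

-- Linear systems over ℚ with more unknowns than equations.

module ℚΣ = Algebra.Properties.Semiring.Sum (CommutativeRing.semiring ℚₚ.+-*-commutativeRing)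

infix 7 _·_

_·_ : ∀ {k} → (Fin k → ℚ) → (Fin k → ℚ) → ℚ
c · r = ℚΣ.sum λ t → c t ℚ.* r t

Σℚ≡sum : ∀ {k} (f : Fin k → ℚ) → Σℚ f ≡ ℚΣ.sum f
Σℚ≡sum {zero}  f = refl
Σℚ≡sum {suc k} f = cong (f zero ℚ.+_) (Σℚ≡sum (f ∘ suc))

·-cong : ∀ {k} (c : Fin k → ℚ) {q r} → (∀ t → q t ≡ r t) → c · q ≡ c · r
·-cong c h = ℚΣ.sum-cong-≗ λ t → cong (c t ℚ.*_) (h t)

·-+ : ∀ {k} (c q r : Fin k → ℚ) → c · (λ t → q t ℚ.+ r t) ≡ c · q ℚ.+ c · r
·-+ {k} c q r = trans (ℚΣ.sum-cong-≗ λ t → ℚₚ.*-distribˡ-+ (c t) (q t) (r t)) (ℚΣ.∑-distrib-+ {k} _ _)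

·-zero : ∀ {k} (c r : Fin k → ℚ) → (∀ t → r t ≡ 0ℚ) → c · r ≡ 0ℚ
·-zero {k} c r h =
  trans (ℚΣ.sum-cong-≗ λ t → trans (cong (c t ℚ.*_) (h t)) (ℚₚ.*-zeroʳ (c t))) (ℚΣ.sum-replicate-zero k)

*-≢0 : ∀ a x → a ≢ 0ℚ → x ≢ 0ℚ → a ℚ.* x ≢ 0ℚ
*-≢0 a x a≢0 x≢0 eq = x≢0 (begin
  x                          ≡⟨ ℚₚ.*-identityˡ x ⟨
  1ℚ ℚ.* x                   ≡⟨ cong (ℚ._* x) (ℚₚ.*-inverseˡ a) ⟨
  (ℚ.1/ a) ℚ.* a ℚ.* x       ≡⟨ ℚₚ.*-assoc (ℚ.1/ a) a x ⟩
  (ℚ.1/ a) ℚ.* (a ℚ.* x)     ≡⟨ cong ((ℚ.1/ a) ℚ.*_) eq ⟩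
  (ℚ.1/ a) ℚ.* 0ℚ            ≡⟨ ℚₚ.*-zeroʳ (ℚ.1/ a) ⟩
  0ℚ                         ∎)
  where
  open ≡-Reasoning
  instance _ = ℚ.≢-nonZero a≢0

-- A Gaussian elimination step without division: `r` is the pivot row and `t` the pivot column,
-- which is dropped.
eliminate : ∀ {k} → (Fin (suc k) → ℚ) → Fin (suc k) → (Fin (suc k) → ℚ) → Fin k → ℚ
eliminate r t q s = r t ℚ.* q (punchIn t s) ℚ.+ (ℚ.- q t) ℚ.* r (punchIn t s)

-- Back substitution: the old unknowns are scaled by the pivot `r t`, and the unknown inserted at
-- `t` is chosen to make the product with `r` vanish.
lift : ∀ {k} → (Fin (suc k) → ℚ) → Fin (suc k) → (Fin k → ℚ) → Fin (suc k) → ℚ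
lift r t c = insertAt (λ s → r t ℚ.* c s) t (ℚ.- (c · λ s → r (punchIn t s)))

lift-· : ∀ {k} (r : Fin (suc k) → ℚ) t c q → lift r t c · q ≡ c · eliminate r t q
lift-· {k} r t c q = begin
  lift r t c · q
    ≡⟨ ℚΣ.sum-remove {i = t} (λ u → lift r t c u ℚ.* q u) ⟩
  lift r t c t ℚ.* q t ℚ.+ ℚΣ.sum (λ s → lift r t c (punchIn t s) ℚ.* q (punchIn t s))
    ≡⟨ cong₂ ℚ._+_ (cong (ℚ._* q t) (insertAt-lookup (λ s → r t ℚ.* c s) t (ℚ.- B)))
         (ℚΣ.sum-cong-≗ λ s → cong (ℚ._* q (punchIn t s))
           (insertAt-punchIn (λ s → r t ℚ.* c s) t (ℚ.- B) s)) ⟩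
  (ℚ.- B) ℚ.* q t ℚ.+ ℚΣ.sum (λ s → r t ℚ.* c s ℚ.* q (punchIn t s))
    ≡⟨ cong (ℚ._+ ℚΣ.sum (λ s → r t ℚ.* c s ℚ.* q (punchIn t s)))
         (trans (swap B (q t)) (ℚΣ.*-distribˡ-sum {k} (ℚ.- q t) _)) ⟩
  ℚΣ.sum (λ s → (ℚ.- q t) ℚ.* (c s ℚ.* r (punchIn t s)))
    ℚ.+ ℚΣ.sum (λ s → r t ℚ.* c s ℚ.* q (punchIn t s))
    ≡⟨ ℚΣ.∑-distrib-+ {k} _ _ ⟨
  ℚΣ.sum (λ s → (ℚ.- q t) ℚ.* (c s ℚ.* r (punchIn t s)) ℚ.+ r t ℚ.* c s ℚ.* q (punchIn t s))
    ≡⟨ ℚΣ.sum-cong-≗ (λ s → rearrange (c s) (r t) (q (punchIn t s)) (ℚ.- q t) (r (punchIn t s))) ⟩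
  c · eliminate r t q ∎
  where
  open ≡-Reasoning
  open ℚSolver.+-*-Solver using (_:+_; _:*_; :-_; _:=_) renaming (solve to solveℚ)
  B = c · λ s → r (punchIn t s)
  swap : ∀ b y → (ℚ.- b) ℚ.* y ≡ (ℚ.- y) ℚ.* b
  swap = solveℚ 2 (λ b y → (:- b) :* y := (:- y) :* b) refl
  rearrange : ∀ c a x y z → y ℚ.* (c ℚ.* z) ℚ.+ a ℚ.* c ℚ.* x ≡ c ℚ.* (a ℚ.* x ℚ.+ y ℚ.* z)
  rearrange = solveℚ 5 (λ c a x y z → y :* (c :* z) :+ a :* c :* x := c :* (a :* x :+ y :* z)) refl

-- Induction on the number of rows: a zero row is dropped, and a row with a pivot is eliminated
-- together with one unknown.
dependency : ∀ {k} (rows : List (Fin k → ℚ)) → length rows ℕ.< k →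
  ∃ λ c → (∃ λ t → c t ≢ 0ℚ) × All (λ r → c · r ≡ 0ℚ) rows
dependency rows = go (length rows) rows refl
  where
  go : ∀ m {k} (rows : List (Fin k → ℚ)) → length rows ≡ m → m ℕ.< k →
    ∃ λ c → (∃ λ t → c t ≢ 0ℚ) × All (λ r → c · r ≡ 0ℚ) rows
  go zero    {suc k} []         _  _       = (λ _ → 1ℚ) , (zero , λ ()) , All.[]
  go (suc m) {suc k} (r ∷ rows) eq (s≤s h) with any? (λ t → ¬? (r t ℚ.≟ 0ℚ))
  ... | no ¬pivot with go m rows (suc-injective eq) (m≤n⇒m≤1+n h)
  ...   | c , nz , zs =
    c , nz , ·-zero c r (λ t → decidable-stable (r t ℚ.≟ 0ℚ) λ ne → ¬pivot (t , ne)) All.∷ zs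
  go (suc m) {suc k} (r ∷ rows) eq (s≤s h) | yes (t , rt≢0)
    with go m (map (eliminate r t) rows) (trans (length-map (eliminate r t) rows) (suc-injective eq)) h
  ... | c , (s , cs≢0) , zs = lift r t c ,
    (punchIn t s , λ z → *-≢0 (r t) (c s) rt≢0 cs≢0
      (trans (≡-sym (insertAt-punchIn (λ s → r t ℚ.* c s) t _ s)) z)) ,
    trans (lift-· r t c r) (·-zero c (eliminate r t r) λ u → cancels (r t) (r (punchIn t u))) All.∷
    All.map (λ {q} → trans (lift-· r t c q)) (All.map⁻ zs)
    where
    cancels : ∀ a x → a ℚ.* x ℚ.+ (ℚ.- a) ℚ.* x ≡ 0ℚ
    cancels a x = trans (≡-sym (ℚₚ.*-distribʳ-+ x a (ℚ.- a)))
                        (trans (cong (ℚ._* x) (ℚₚ.+-inverseʳ a)) (ℚₚ.*-zeroˡ x))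

-- From near-mincuts to stars and covered edges.

-- With α = num / (p + 1) in lowest terms, α < 2 forces the integer num to be at most 2 (p + 1) - 1.
near-ratio : ∀ α → α < (+ 2) / 1 → ∃ λ p → ∀ w w′ →
  ℕ→ℚ w ≤ α ℚ.* ℕ→ℚ w′ → (1 + p) * w ℕ.≤ (1 + 2 * p) * w′
near-ratio α@(mkℚ num p _) α<2 = p , λ w w′ h → ℤₚ.drop‿+≤+ (begin
  + ((1 + p) * w)            ≡⟨ cong +_ (trans (*-comm (1 + p) w)
                                  (cong (λ x → w * suc x) (≡-sym (*-identityʳ p)))) ⟩
  + (w * suc (p * 1))        ≡⟨ ℤₚ.pos-* w _ ⟩
  + w ℤ.* + suc (p * 1)      ≤⟨ ℚᵘₚ.drop-*≤* (unnormalise w w′ h) ⟩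
  num ℤ.* + w′ ℤ.* + 1       ≡⟨ ℤₚ.*-identityʳ (num ℤ.* + w′) ⟩
  num ℤ.* + w′               ≤⟨ ℤₚ.*-monoʳ-≤-nonNeg (+ w′) num≤ ⟩
  + (1 + 2 * p) ℤ.* + w′     ≡⟨ ℤₚ.pos-* (1 + 2 * p) w′ ⟨
  + ((1 + 2 * p) * w′)       ∎)
  where
  open ℤₚ.≤-Reasoning
  num≤ : num ℤ.≤ + (1 + 2 * p)
  num≤ = subst₂ ℤ._≤_ (ℤₚ.*-identityʳ num) (cong +_ (step p)) (ℤₚ.i<j⇒i≤pred[j] (ℚₚ.drop-*<* α<2))
    where
    step : ∀ p → p + 1 * suc p ≡ 1 + 2 * p
    step p = solve (p ∷ [])
  -- Unnormalised fractions avoid the reduction to lowest terms, so the inequality becomes a cross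
  -- multiplication.
  unnormalise : ∀ w w′ → ℕ→ℚ w ≤ α ℚ.* ℕ→ℚ w′ →
    mkℚᵘ (+ w) 0 ℚᵘ.≤ mkℚᵘ num p ℚᵘ.* mkℚᵘ (+ w′) 0
  unnormalise w w′ h =
    ℚᵘₚ.≤-respˡ-≃ (ℚₚ.toℚᵘ-fromℚᵘ (mkℚᵘ (+ w) 0))
      (ℚᵘₚ.≤-respʳ-≃ (ℚᵘₚ.≃-trans (ℚₚ.toℚᵘ-homo-* α (ℕ→ℚ w′))
                        (ℚᵘₚ.*-congˡ {mkℚᵘ num p} (ℚₚ.toℚᵘ-fromℚᵘ (mkℚᵘ (+ w′) 0))))
        (ℚₚ.toℚᵘ-mono-≤ h))

-- Comparing with `X v` admits both {v} and its complement, which have the same cut.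
IsStar : ∀ {n} → VertexSet n → Set
IsStar X = ∃ λ v → ∀ u → X u ≡ X v → u ≡ v

isStar? : ∀ {n} (X : VertexSet n) → Dec (IsStar X)
isStar? X = any? λ v → all? λ u → (X u 𝔹.≟ X v) →-dec (u ≟ v)

¬star⇒twin : ∀ {n} (X : VertexSet n) → ¬ IsStar X → ∀ v → ∃ λ u → u ≢ v × X u ≡ X v
¬star⇒twin {n} X ¬star v
  with ¬∀⟶∃¬ n _ (λ u → (X u 𝔹.≟ X v) →-dec (u ≟ v)) (λ h → ¬star (v , h))
... | u , h = u , (λ eq → h λ _ → eq) ,
  decidable-stable (X u 𝔹.≟ X v) λ ne → h λ eq → ⊥-elim (ne eq)

argmin : ∀ {n} (f : Fin n → ℕ) → Fin n → ∃ λ i → ∀ j → f i ℕ.≤ f j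
argmin {suc zero} f _ = zero , λ { zero → ≤-refl }
argmin {suc (suc n)} f _ with argmin (f ∘ suc) zero
... | i , h with ≤-total (f zero) (f (suc i))
...   | inj₁ le = zero , λ { zero → ≤-refl ; (suc j) → ≤-trans le (h j) }
...   | inj₂ le = suc i , λ { zero → le ; (suc j) → h j }

𝟙 : Bool → ℚ
𝟙 b = if b then 1ℚ else 0ℚ

-- The entry of χ(Δ(X t)) at an edge ij is vertexRow i + vertexRow j + edgeRow ij. When Δ(X t) is
-- the star of two different vertices (n = 2), isStar? selects one of them.
vertexRow : ∀ {n k} → (Fin k → VertexSet n) → Fin n → Fin k → ℚ
vertexRow X u t with isStar? (X t)
... | yes (v , _) = 𝟙 (does (u ≟ v))
... | no _        = 0ℚ

edgeRow : ∀ {n k} → (Fin k → VertexSet n) → Fin n × Fin n → Fin k → ℚ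
edgeRow X (i , j) t with isStar? (X t)
... | yes _ = 0ℚ
... | no _  = 𝟙 (crosses (X t) i j)

edgeRow-zero : ∀ {n k} (X : Fin k → VertexSet n) i j t →
  (¬ IsStar (X t) → crosses (X t) i j ≡ false) → edgeRow X (i , j) t ≡ 0ℚ
edgeRow-zero X i j t h with isStar? (X t)
... | yes _    = refl
... | no ¬star = cong 𝟙 (h ¬star)

≢⇒xor : ∀ x y → x ≢ y → x xor y ≡ true
≢⇒xor true  true  h = ⊥-elim (h refl)
≢⇒xor true  false h = refl
≢⇒xor false true  h = refl
≢⇒xor false false h = ⊥-elim (h refl)

≢≢⇒¬xor : ∀ x y z → x ≢ z → y ≢ z → x xor y ≡ false
≢≢⇒¬xor true  true  z     _ _ = refl
≢≢⇒¬xor true  false true  h _ = ⊥-elim (h refl)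
≢≢⇒¬xor true  false false _ h = ⊥-elim (h refl)
≢≢⇒¬xor false true  true  _ h = ⊥-elim (h refl)
≢≢⇒¬xor false true  false h _ = ⊥-elim (h refl)
≢≢⇒¬xor false false z     _ _ = refl

crosses-rows : ∀ {n k} (X : Fin k → VertexSet n) i j → i ≢ j → ∀ t →
  𝟙 (crosses (X t) i j) ≡ vertexRow X i t ℚ.+ vertexRow X j t ℚ.+ edgeRow X (i , j) t
crosses-rows X i j i≢j t with isStar? (X t)
... | no _ = ≡-sym (ℚₚ.+-identityˡ (𝟙 (crosses (X t) i j)))
... | yes (v , h) with i ≟ v | j ≟ v
...   | yes refl | yes refl = ⊥-elim (i≢j refl)
...   | yes refl | no j≢v   = cong 𝟙 (≢⇒xor (X t i) (X t j) λ eq → j≢v (h j (≡-sym eq)))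
...   | no i≢v   | yes refl = cong 𝟙 (≢⇒xor (X t i) (X t j) λ eq → i≢v (h i eq))
-- Both ends differ from `v`, hence lie on the side opposite to it, and the edge is not in the star.
...   | no i≢v   | no j≢v   =
  cong 𝟙 (≢≢⇒¬xor (X t i) (X t j) (X t v) (λ eq → i≢v (h i eq)) λ eq → j≢v (h j eq))

-- The dimension bound.

module Dimension {n} (G : SimpleGraph n) (α : ℚ) (p : ℕ)
                 (ratio : ∀ w w′ → ℕ→ℚ w ≤ α ℚ.* ℕ→ℚ w′ → (1 + p) * w ℕ.≤ (1 + 2 * p) * w′)
                 {k} (X : Fin k → VertexSet n) (near : ∀ t → NearMincut α G (X t))
                 (x y : Fin n) (x≢y : x ≢ y) where

  open Cuts G

  v₀ : Fin n
  v₀ = proj₁ (argmin (λ v → e v (λ _ → true)) x)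

  d : ℕ
  d = e v₀ (λ _ → true)

  min-degree : ∀ v → d ℕ.≤ e v (λ _ → true)
  min-degree = proj₂ (argmin (λ v → e v (λ _ → true)) x)

  open NearCuts G p d min-degree

  W-ratio : ∀ t Y → IsCut Y → (1 + p) * W (X t) ℕ.≤ (1 + 2 * p) * W Y
  W-ratio t Y cut = subst₂ (λ a b → (1 + p) * a ℕ.≤ (1 + 2 * p) * b) (cutWeight≡W (X t)) (cutWeight≡W Y)
    (ratio _ _ (proj₂ (near t) Y cut))

  star : VertexSet n
  star u = does (u ≟ v₀)

  W-star : W star ℕ.≤ d
  W-star = ≤-trans (≤-reflexive (sum-δ v₀ (λ u → e u (∁ star)))) (e-mono v₀ λ _ _ → refl)

  star-cut : IsCut star
  star-cut = (v₀ , dec-true (v₀ ≟ v₀) refl) , other (x ≟ v₀)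
    where
    other : Dec (x ≡ v₀) → ∃ λ v → star v ≡ false
    other (yes x≡v₀) = y , dec-false (y ≟ v₀) λ y≡v₀ → x≢y (trans x≡v₀ (≡-sym y≡v₀))
    other (no x≢v₀)  = x , dec-false (x ≟ v₀) x≢v₀

  nearCut : ∀ t → ¬ IsStar (X t) → NearCut (X t)
  nearCut t ¬star = record
    { nontrivial   = ¬star⇒twin (X t) ¬star
    -- The star of a vertex of minimum degree is a cut of weight at most `d`.
    ; below-degree = ≤-trans (W-ratio t star star-cut) ((1 + 2 * p) *≤ W-star)
    ; below-cuts   = W-ratio t
    }

  open Cover G p d min-degree X (λ t → ¬ IsStar (X t)) (λ t → ¬? (isStar? (X t))) nearCut

  rows : List (Fin n × Fin n) → List (Fin k → ℚ)
  rows L = map (vertexRow X) (allFin n) ++ map (edgeRow X) L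

  length-rows : ∀ L → length (rows L) ≡ n + length L
  length-rows L = trans (length-++ (map (vertexRow X) (allFin n)))
    (cong₂ _+_ (trans (length-map (vertexRow X) (allFin n)) (length-tabulate (λ (i : Fin n) → i)))
               (length-map (edgeRow X) L))

  -- The rows are linear conditions on the coefficients `c`. An edge crossed by some non-star cut
  -- has its row in the list; for any other edge the edge row is zero.
  χ-relation : ∀ L → Covers (λ _ → true) L → ∀ c → All (λ r → c · r ≡ 0ℚ) (rows L) →
    ∀ (ε : Edge G) → Σℚ (λ t → c t ℚ.* χΔ G (X t) ε) ≡ 0ℚ
  χ-relation L covers c zs ((i , j) , i<j , a) = begin
    Σℚ (λ t → c t ℚ.* 𝟙 (crosses (X t) i j))
      ≡⟨ Σℚ≡sum (λ t → c t ℚ.* 𝟙 (crosses (X t) i j)) ⟩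
    c · (λ t → 𝟙 (crosses (X t) i j))
      ≡⟨ ·-cong c (crosses-rows X i j (<⇒≢ i<j)) ⟩
    c · (λ t → vertexRow X i t ℚ.+ vertexRow X j t ℚ.+ edgeRow X (i , j) t)
      ≡⟨ trans (·-+ c _ (edgeRow X (i , j)))
           (cong (ℚ._+ c · edgeRow X (i , j)) (·-+ c (vertexRow X i) (vertexRow X j))) ⟩
    c · vertexRow X i ℚ.+ c · vertexRow X j ℚ.+ c · edgeRow X (i , j)
      ≡⟨ cong₂ ℚ._+_ (cong₂ ℚ._+_ (vertex i) (vertex j)) edge ⟩
    0ℚ ∎
    where
    open ≡-Reasoning
    vertex : ∀ u → c · vertexRow X u ≡ 0ℚ
    vertex u = All.lookup zs (∈-++⁺ˡ (∈-map⁺ (vertexRow X) (∈-allFin u)))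
    edge : c · edgeRow X (i , j) ≡ 0ℚ
    edge = by (any? λ t → ¬? (isStar? (X t)) ×-dec (crosses (X t) i j 𝔹.≟ true))
      where
      by : Dec (∃ λ t → ¬ IsStar (X t) × crosses (X t) i j ≡ true) → c · edgeRow X (i , j) ≡ 0ℚ
      by (yes (t , ¬star , cr)) = All.lookup zs (∈-++⁺ʳ (map (vertexRow X) (allFin n))
        (∈-map⁺ (edgeRow X) (covers t ¬star i j i<j a refl refl cr)))
      by (no none) = ·-zero c (edgeRow X (i , j)) λ t →
        edgeRow-zero X i j t λ ¬star → ¬-not λ cr → none (t , ¬star , cr)

  -- With more vectors than rows, `dependency` would give a nonzero relation between them.
  independent⇒≤ : LinearlyIndependent (λ t → χΔ G (X t)) → k ℕ.≤ (1 + (4 * M + 16 * M * M)) * n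
  independent⇒≤ indep =
    ≤-trans few (≤-trans (≤-reflexive (length-rows L)) (≤-refl {n} +≤ proj₂ (proj₂ cover)))
    where
    cover = linear-cover x
    L = proj₁ cover
    few : k ℕ.≤ length (rows L)
    few = ≮⇒≥ λ lt → let c , (t , ct≢0) , zs = dependency (rows L) lt in
      ct≢0 (indep c (χ-relation L (proj₁ (proj₂ cover)) c zs) t)

theorem8p1 : (α : ℚ) → 1ℚ ≤ α → α < (+ 2) / 1 →
    ∃ λ (C : ℕ) → ∀ (n : ℕ) (G : SimpleGraph n) → CdimAtMost α G (C * n)
theorem8p1 α _ α<2 = C , bound
  where
  p = proj₁ (near-ratio α α<2)
  M = 4 * (2 * (1 + p))
  C = 1 + (4 * M + 16 * M * M)
  bound : ∀ n (G : SimpleGraph n) → CdimAtMost α G (C * n)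
  bound n G zero    X near indep = z≤n
  -- The two sides of the first cut supply two different vertices, which make the minimum-degree
  -- star a cut.
  bound n G (suc k) X near indep =
    let (x , Xx) , (y , Xy) = proj₁ (near zero) in
    Dimension.independent⇒≤ G α p (proj₂ (near-ratio α α<2)) X near x y
      (λ x≡y → case trans (≡-sym Xx) (trans (cong (X zero) x≡y) Xy) of λ ()) indep
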